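{- There is an absolute constant $A>0$ such that for every instance of Precedence-Constrained Parallel Densest Subfamily (PCPDS) with unit cost sets and $k$ sets, the algorithm PREC-DENSE (described in the context) returns a precedence-closed assignment $\mathcal{F}$ such that $$\Delta(\mathcal{F}^*,\mathcal{U})\le A\cdot k^{2/3}\cdot\Delta(\mathcal{F},\mathcal{U}),$$ where $\mathcal{F}^*$ is an optimal (maximum density) precedence-closed assignment of sets to machines.
   Context: Notation: $\mathbb{N}=\{1,2,\dots\}$ and $[m]=\{1,\dots,m\}$. PCPDS instance with unit cost sets: a finite universe $\mathcal{U}$, a collection $\mathcal{S}$ of $k\ge1$ subsets of $\mathcal{U}$ with $\bigcup_{S\in\mathcal{S}}S=\mathcal{U}$, a number $m\ge1$ of identical machines, weights $w:\mathcal{U}\to\mathbb{N}$, and a directed acyclic graph $G$ on $\mathcal{S}$ giving precedence constraints (if there is a directed path from $S_1$ to $S_2$, then $S_1$ is a predecessor of $S_2$ and must be completed before $S_2$ is started). Processing any set takes one unit of time on any machine. An assignment $\mathcal{F}$ schedules some (at least one) of the sets on the $m$ machines, each scheduled set being processed once, on one machine, during one unit time slot, with at most one set per machine per slot (machines may idle). It is precedence-closed if for every scheduled set $S$ all its predecessors are scheduled and completed before $S$ starts. Its length $|\mathcal{F}|$ is the time at which the last scheduled set is completed. With $\operatorname{cov}(\mathcal{F},\mathcal{U})$ the union of all scheduled sets and $w(\mathcal{U}')=\sum_{u\in\mathcal{U}'}w(u)$, the density is $\Delta(\mathcal{F},\mathcal{U})=w(\operatorname{cov}(\mathcal{F},\mathcal{U}))/|\mathcal{F}|$.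 PCPDS asks for a precedence-closed assignment of maximum density. The depth of $S\in\mathcal{S}$ is the number of vertices on a longest directed path in $G$ ending at $S$; $d$ is the maximum depth. $\mathcal{P}(S)$ is the set consisting of $S$ and all its predecessors. List-Scheduling of a predecessor-closed family: starting from time $0$, repeatedly take an unscheduled set of the family all of whose predecessors have been processed and assign it to a machine available at the soonest time, processing the sets in order of nondecreasing depth (layer by layer). Algorithm PREC-DENSE: for each $h\in[d]$, let $\mathcal{F}_h$ be the assignment obtained by List-Scheduling all sets of depth at most $h$; for each $S\in\mathcal{S}$, let $\mathcal{F}_S$ be the assignment obtained by List-Scheduling the sets in $\mathcal{P}(S)$. Return an assignment of maximum density among all $\mathcal{F}_h$ ($h\in[d]$) and $\mathcal{F}_S$ ($S\in\mathcal{S}$). -}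

module Defs where

open import Data.Fin using (Fin; toℕ)
open import Data.Fin.Induction using (spo-wellFounded)
open import Data.Fin.Subset using (Subset; ⋃; ⊤)
open import Data.Fin.Subset.Properties using (_∈?_)
open import Data.Integer using (+_)
open import Data.List using (List; allFin; filter; filterᵇ; map; sum; tabulate)
open import Data.List.Extrema.Nat using (argmax; max; f[⊥]≤f[argmax]; f[xs]≤f[argmax]; v<max⁺)
open import Data.List.Membership.Propositional.Properties using (∈-allFin; ∈-map⁺)
import Data.List.Relation.Unary.All as All
import Data.List.Relation.Unary.Any as Any
open import Data.Maybe using (Maybe; just; nothing; is-just)
open import Data.Nat using (ℕ; suc; _≤_; _<_; _≥_; NonZero; >-nonZero; s≤s; z≤n)
open import Data.Nat.Properties using (≤-trans)
open import Data.Product using (∃; ∃₂; _×_; _,_; proj₁; proj₂)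
open import Data.Rational as ℚ using (ℚ)
open import Data.Sum using (_⊎_; inj₁; inj₂)
open import Data.Vec using (Vec; lookup; replicate; _[_]≔_)
open import Induction.WellFounded using (WellFounded; Acc; acc)
open import Level using (0ℓ)
open import Relation.Binary.Core using (Rel)
open import Relation.Binary.Definitions using (Decidable)
open import Relation.Binary.Construct.Closure.Transitive using (TransClosure; [_]; _++_)
open import Relation.Binary.PropositionalEquality
  using (_≡_; _≢_; refl; sym; subst; isEquivalence; resp₂)
open import Relation.Nullary using (¬_; yes; no)
open import Relation.Unary using (Pred)

-- For nonnegative x, y and A, the bound x ≤ A · k^(2/3) · y, whose factor k^(2/3)
-- is in general irrational, is equivalent to x ³ ≤ A ³ * k² * y ³.
infixl 8 _³

_³ : ℚ → ℚ
q ³ = q ℚ.* q ℚ.* q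

-- The universe is Fin n, and the collection is a family indexed by Fin k
-- (two indices may carry equal subsets).
record Instance : Set₁ where
  field
    n k m      : ℕ
    k≥1        : k ≥ 1
    m≥1        : m ≥ 1
    sets       : Fin k → Subset n
    covering   : ⋃ (tabulate sets) ≡ ⊤
    w          : Fin n → ℕ
    w≥1        : ∀ u → w u ≥ 1
    _⟶_        : Rel (Fin k) 0ℓ
    _⟶?_       : Decidable _⟶_
    acyclic    : ∀ i → ¬ TransClosure _⟶_ i i

module _ (I : Instance) where
  open Instance I

  Predecessor : Rel (Fin k) 0ℓ
  Predecessor = TransClosure _⟶_

  weight : Subset n → ℕ
  weight U = sum (map w (filter (_∈? U) (allFin n)))

  -- The entry of a set is nothing if the set is not scheduled, and just (μ , t)
  -- if it is processed on machine μ during the time slot [t , t + 1].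
  Slots : Set
  Slots = Vec (Maybe (Fin m × ℕ)) k

  Scheduled : Slots → Pred (Fin k) 0ℓ
  Scheduled s i = ∃ λ p → lookup s i ≡ just p

  CompletedBy : Slots → ℕ → Pred (Fin k) 0ℓ
  CompletedBy s t i = ∃₂ λ μ t′ → lookup s i ≡ just (μ , t′) × suc t′ ≤ t

  record Assignment : Set where
    field
      slots        : Slots
      conflictFree : ∀ {i j p} → lookup slots i ≡ just p → lookup slots j ≡ just p → i ≡ j
      nonempty     : ∃ (Scheduled slots)

  open Assignment

  PrecedenceClosed : Pred Assignment 0ℓ
  PrecedenceClosed F = ∀ {i μ t} → lookup (slots F) i ≡ just (μ , t) →
    ∀ j → Predecessor j i → CompletedBy (slots F) t j

  completion : Maybe (Fin m × ℕ) → ℕ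
  completion nothing        = 0
  completion (just (_ , t)) = suc t

  duration : Assignment → ℕ
  duration F = max 0 (map (λ i → completion (lookup (slots F) i)) (allFin k))

  duration-nonZero : ∀ F → NonZero (duration F)
  duration-nonZero F with nonempty F
  ... | i , (μ , t) , eq = >-nonZero (v<max⁺ 0 _ (inj₂
    (Any.map (λ {x} i≡x → subst (0 <_) i≡x (subst (λ p → 0 < completion p) (sym eq) (s≤s z≤n)))
      (∈-map⁺ (λ i → completion (lookup (slots F) i)) (∈-allFin i)))))

  cov : Assignment → Subset n
  cov F = ⋃ (map sets (filterᵇ (λ i → is-just (lookup (slots F) i)) (allFin k)))

  density : Assignment → ℚ
  density F = ℚ._/_ (+ weight (cov F)) (duration F) {{duration-nonZero F}}

  Optimal : Pred Assignment 0ℓ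
  Optimal F = PrecedenceClosed F × (∀ F′ → PrecedenceClosed F′ → density F′ ℚ.≤ density F)

  -- PathTo i l: a directed path with l vertices ending at i.  Vertices never
  -- repeat because the graph is acyclic.
  data PathTo : Fin k → ℕ → Set where
    start : ∀ i → PathTo i 1
    _▻_   : ∀ {i j l} → PathTo j l → j ⟶ i → PathTo i (suc l)

  IsDepth : Fin k → ℕ → Set
  IsDepth i h = PathTo i h × (∀ l → PathTo i l → l ≤ h)

  predecessor-wellFounded : WellFounded Predecessor
  predecessor-wellFounded = spo-wellFounded record
    { isEquivalence = isEquivalence
    ; irrefl        = λ { refl p → acyclic _ p }
    ; trans         = _++_
    ; <-resp-≈      = resp₂ Predecessor
    }

  depth-exists : ∀ i → ∃ (IsDepth i)
  depth-exists i = go i (predecessor-wellFounded i)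
    where
    go : ∀ i → Acc Predecessor i → ∃ (IsDepth i)
    go i (acc rs) = proj₁ best , proj₂ best , bound
      where
      rec : ∀ j → j ⟶ i → ∃ (IsDepth j)
      rec j e = go j (rs [ e ])

      candidate : Fin k → ∃ (PathTo i)
      candidate j with j ⟶? i
      ... | yes e = suc (proj₁ (rec j e)) , proj₁ (proj₂ (rec j e)) ▻ e
      ... | no _  = 1 , start i

      candidates : List (∃ (PathTo i))
      candidates = map candidate (allFin k)

      best : ∃ (PathTo i)
      best = argmax proj₁ (1 , start i) candidates

      candidate-bound : ∀ {j l} → PathTo j l → j ⟶ i → suc l ≤ proj₁ (candidate j)
      candidate-bound {j} {l} p e with j ⟶? i
      ... | yes e′ = s≤s (proj₂ (proj₂ (rec j e′)) l p)
      ... | no ¬e  with () ← ¬e e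

      bound : ∀ l → PathTo i l → l ≤ proj₁ best
      bound _ (start _)         = f[⊥]≤f[argmax] {f = proj₁} (1 , start i) candidates
      bound _ (_▻_ {j = j} p e) = ≤-trans (candidate-bound p e)
        (All.lookup (f[xs]≤f[argmax] {f = proj₁} (1 , start i) candidates)
                    (∈-map⁺ candidate (∈-allFin j)))

  depth : Fin k → ℕ
  depth i = proj₁ (depth-exists i)

  maxDepth : ℕ
  maxDepth = max 0 (map depth (allFin k))

  Available : Slots → Fin k → Fin m → ℕ → Set
  Available s i μ t = (∀ j → lookup s j ≢ just (μ , t))
                    × (∀ j → Predecessor j i → CompletedBy s t j)

  -- ListRun 𝒯 s: s is reachable by list-scheduling sets of the family 𝒯.  Every
  -- resolution of ties (which set of least depth, which machine) is allowed.
  data ListRun (𝒯 : Pred (Fin k) 0ℓ) : Slots → Set where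
    empty : ListRun 𝒯 (replicate k nothing)
    step  : ∀ {s} i μ t → ListRun 𝒯 s →
            𝒯 i → lookup s i ≡ nothing →
            (∀ j → 𝒯 j → lookup s j ≡ nothing → depth i ≤ depth j) →
            Available s i μ t →
            (∀ μ′ t′ → Available s i μ′ t′ → t ≤ t′) →
            ListRun 𝒯 (s [ i ]≔ just (μ , t))

  ListScheduling : Pred (Fin k) 0ℓ → Pred Assignment 0ℓ
  ListScheduling 𝒯 F = ListRun 𝒯 (slots F) × (∀ i → 𝒯 i → Scheduled (slots F) i)

  DepthAtMost : ℕ → Pred (Fin k) 0ℓ
  DepthAtMost h i = depth i ≤ h

  𝒫 : Fin k → Pred (Fin k) 0ℓ
  𝒫 i j = j ≡ i ⊎ Predecessor j i

  -- F is a possible output of PREC-DENSE.  The layer bound h ∈ {1, …, maxDepth}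
  -- is suc (toℕ a) for a : Fin maxDepth.
  record PrecDense (F : Assignment) : Set where
    field
      layer         : Fin maxDepth → Assignment
      layer-list    : ∀ a → ListScheduling (DepthAtMost (suc (toℕ a))) (layer a)
      cone          : Fin k → Assignment
      cone-list     : ∀ i → ListScheduling (𝒫 i) (cone i)
      candidate     : (∃ λ a → F ≡ layer a) ⊎ (∃ λ i → F ≡ cone i)
      layer-density : ∀ a → density (layer a) ℚ.≤ density F
      cone-density  : ∀ i → density (cone i) ℚ.≤ density F

-- Let F* be a precedence-closed assignment of length L scheduling T sets, and D
-- the density returned.  Graham's argument bounds the length of a list schedule of
-- N sets of depth at most H by H + N/m.  All sets of F* have depth at most L, so
-- the layer h = min(L, d) covers all that F* covers, in time L + k/m; hence
-- Δ(F*) ≤ D (1 + k/(mL)).  The cone of a set of F* takes time L + T/m ≤ 2L, and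
-- summing the weights of the T sets gives Δ(F*) ≤ 2 T D.  As T ≤ k and T ≤ mL,
-- these yield Δ(F*) ≤ 2 k D and Δ(F*)² ≤ 4 k D², whose product is the claim
-- with A = 2 (the second alone even gives the ratio 2 √k).

module Submission where

open import Defs
open import Data.Bool using (if_then_else_; T)
open import Data.Bool.Properties using (T?)
open import Data.Fin using (Fin; zero; suc; toℕ; fromℕ<)
open import Data.Fin.Properties using (all?; any?; injective⇒≤; toℕ-fromℕ<)
import Data.Fin.Properties as Fin
open import Data.Fin.Subset using (Subset; ⋃; _∪_; ⊥; _⊆_)
open import Data.Fin.Subset.Properties using (_∈?_; ∉⊥; x∈p∪q⁻; p⊆p∪q; q⊆p∪q)
open import Data.Integer using (+_)
import Data.Integer as ℤ
import Data.Integer.Properties as ℤ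
open import Data.List using (List; []; _∷_; _++_; allFin; cartesianProduct; filter; filterᵇ; length; map; upTo)
import Data.List as List
import Data.List.Extrema
open import Data.List.Extrema.Nat using (argmin; argmin-all; f[argmin]≤f[xs]; argmax-all; max; xs≤max)
open import Data.List.Membership.Propositional using () renaming (_∈_ to _∈ₗ_)
open import Data.List.Membership.Propositional.Properties
  using (∈-allFin; ∈-lookup; ∈-map⁺; ∈-map⁻; ∈-++⁺ˡ; ∈-++⁺ʳ; ∈-++⁻; ∈-filter⁺; ∈-filter⁻; ∈-upTo⁺;
         ∈-cartesianProduct⁺; ∈-cartesianProduct⁻)
open import Data.List.Properties using (length-++; length-map; length-tabulate; length-upTo; length-filter; filter-none)
open import Data.List.Relation.Unary.All using (All; []; _∷_)
import Data.List.Relation.Unary.All as All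
import Data.List.Relation.Unary.All.Properties as All
open import Data.List.Relation.Unary.Any using (here; there; index)
open import Data.List.Relation.Unary.Any.Properties using (lookup-index)
open import Data.List.Relation.Unary.AllPairs using ([]; _∷_)
open import Data.List.Relation.Unary.Unique.Propositional using (Unique)
import Data.List.Relation.Unary.Unique.Propositional.Properties as Unique
open import Data.Maybe using (Maybe; just; nothing; is-just)
open import Data.Maybe.Properties using (just-injective; ≡-dec)
open import Data.Nat as ℕ using (ℕ; zero; suc; z≤n; s≤s; NonZero; _⊓_)
open import Data.Nat.ListAction using (sum)
import Data.Nat.Properties as ℕ
open import Data.Nat.Tactic.RingSolver using (solve-∀)
open import Data.Product using (Σ; ∃; ∃₂; _×_; _,_; proj₁; proj₂)
import Data.Product as Product
import Data.Product.Properties as Product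
open import Data.Rational using (ℚ; 0ℚ; _<_; _≤_; _*_; _/_; toℚᵘ)
import Data.Rational.Properties as ℚ
open import Data.Rational.Unnormalised using (mkℚᵘ; *≤*)
import Data.Rational.Unnormalised as ℚᵘ
import Data.Rational.Unnormalised.Properties as ℚᵘ
open import Data.Sum using (_⊎_; inj₁; inj₂)
import Data.Sum as Sum
open import Data.Vec using (Vec; []; _∷_; lookup; _[_]≔_)
open import Data.Vec.Properties using (lookup∘update; lookup∘update′; lookup-replicate)
open import Data.Unit using (tt)
open import Function using (_∘_; case_of_)
open import Induction.WellFounded using (Acc; acc)
open import Level using (0ℓ)
open import Relation.Binary.Bundles using (DecTotalOrder)
open import Relation.Binary.Construct.Closure.Transitive using ([_]; _∷_; _∷ʳ_) renaming (_++_ to _++⁺_)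
open import Relation.Binary.PropositionalEquality using (_≡_; _≢_; refl; sym; trans; cong; cong₂; subst)
open import Relation.Nullary using (Dec; yes; no; does; contradiction)
open import Relation.Nullary.Decidable using (map′; _×-dec_; _⊎-dec_; _→-dec_; ¬?; decidable-stable)
open import Relation.Unary using (Pred; Decidable)

-- Counting, minimisation and sums over finite lists.

lookup-injective : ∀ {A : Set} {xs : List A} → Unique xs →
                   ∀ i j → List.lookup xs i ≡ List.lookup xs j → i ≡ j
lookup-injective (_ ∷ _)  zero    zero    _  = refl
lookup-injective (x∉ ∷ _) zero    (suc j) eq = contradiction eq (All.lookup x∉ (∈-lookup j))
lookup-injective (x∉ ∷ _) (suc i) zero    eq = contradiction (sym eq) (All.lookup x∉ (∈-lookup i))
lookup-injective (_ ∷ u)  (suc i) (suc j) eq = cong suc (lookup-injective u i j eq)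

-- Pigeonhole for a relation instead of a function: images are often known only through an existence
-- proof. It is applied in both directions between sets and cells (machine, slot) of a schedule.
length-injection : ∀ {A B : Set} (R : A → B → Set) {xs : List A} {ys : List B} → Unique xs →
                   (∀ {x} → x ∈ₗ xs → ∃ λ y → y ∈ₗ ys × R x y) →
                   (∀ {x x′ y} → R x y → R x′ y → x ≡ x′) →
                   length xs ℕ.≤ length ys
length-injection R {xs} {ys} u image inj = injective⇒≤ {f = f} f-injective
  where
  f : Fin (length xs) → Fin (length ys)
  f i = index (proj₁ (proj₂ (image (∈-lookup i))))

  R-f : ∀ i → R (List.lookup xs i) (List.lookup ys (f i))
  R-f i with image (∈-lookup {xs = xs} i)
  ... | y , y∈ys , r = subst (R _) (lookup-index y∈ys) r

  f-injective : ∀ {i j} → f i ≡ f j → i ≡ j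
  f-injective {i} {j} eq = lookup-injective u i j
    (inj (R-f i) (subst (R _ ∘ List.lookup ys) (sym eq) (R-f j)))

length-cartesianProduct : ∀ {A B : Set} (xs : List A) (ys : List B) →
                          length (cartesianProduct xs ys) ≡ length xs ℕ.* length ys
length-cartesianProduct []       ys = refl
length-cartesianProduct (x ∷ xs) ys = trans (length-++ (map (x ,_) ys))
  (cong₂ ℕ._+_ (length-map (x ,_) ys) (length-cartesianProduct xs ys))

length-allFin : ∀ n → length (allFin n) ≡ n
length-allFin n = length-tabulate {n = n} (λ i → i)

minimiser : ∀ {n} {P : Pred (Fin n) 0ℓ} → Decidable P → (f : Fin n → ℕ) → ∃ P →
            ∃ λ i → P i × (∀ j → P j → f i ℕ.≤ f j)
minimiser {n} P? f (i , p) =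
  argmin f i xs ,
  argmin-all f p (All.all-filter P? (allFin n)) ,
  λ j q → All.lookup (f[argmin]≤f[xs] {f = f} i xs) (∈-filter⁺ P? (∈-allFin j) q)
  where xs = filter P? (allFin n)

-- The known witness `t` bounds the search, and the recursion is structural in it.
least : ∀ {P : Pred ℕ 0ℓ} → Decidable P → ∀ t → P t → ∃ λ t → P t × (∀ t′ → P t′ → t ℕ.≤ t′)
least P? t p with P? 0
... | yes p₀ = 0 , p₀ , λ _ _ → z≤n
least P? zero    p | no ¬p₀ = contradiction p ¬p₀
least P? (suc t) p | no ¬p₀ with least (P? ∘ suc) t p
... | u , q , minimal = suc u , q , λ where
  zero     p₀ → contradiction p₀ ¬p₀
  (suc t′) p′ → s≤s (minimal t′ p′)

module _ {A : Set} {P Q R : Pred A 0ℓ} (P? : Decidable P) (Q? : Decidable Q) (R? : Decidable R)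
         (f : A → ℕ) where

  private
    total : ∀ {S : Pred A 0ℓ} → Decidable S → List A → ℕ
    total S? xs = sum (map f (filter S? xs))

    term : ∀ {S : Pred A 0ℓ} → Decidable S → A → ℕ
    term S? x = if does (S? x) then f x else 0

    total-∷ : ∀ {S : Pred A 0ℓ} (S? : Decidable S) x xs → total S? (x ∷ xs) ≡ term S? x ℕ.+ total S? xs
    total-∷ S? x xs with S? x
    ... | yes _ = refl
    ... | no  _ = refl

  -- This one inequality yields both the subadditivity of weights and, with an empty `R`, their
  -- monotonicity.
  sum-filter-∪ : (∀ {x} → P x → Q x ⊎ R x) → ∀ xs → total P? xs ℕ.≤ total Q? xs ℕ.+ total R? xs
  sum-filter-∪ P⊆Q∪R []       = z≤n
  sum-filter-∪ P⊆Q∪R (x ∷ xs) = begin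
    total P? (x ∷ xs)                                             ≡⟨ total-∷ P? x xs ⟩
    term P? x ℕ.+ total P? xs                                     ≤⟨ ℕ.+-mono-≤ term-≤ (sum-filter-∪ P⊆Q∪R xs) ⟩
    (term Q? x ℕ.+ term R? x) ℕ.+ (total Q? xs ℕ.+ total R? xs)   ≡⟨ interchange (term Q? x) (term R? x) _ _ ⟩
    (term Q? x ℕ.+ total Q? xs) ℕ.+ (term R? x ℕ.+ total R? xs)   ≡⟨ cong₂ ℕ._+_ (total-∷ Q? x xs) (total-∷ R? x xs) ⟨
    total Q? (x ∷ xs) ℕ.+ total R? (x ∷ xs)                       ∎
    where
    open ℕ.≤-Reasoning
    interchange : ∀ a b c d → (a ℕ.+ b) ℕ.+ (c ℕ.+ d) ≡ (a ℕ.+ c) ℕ.+ (b ℕ.+ d)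
    interchange = solve-∀
    term-≤ : term P? x ℕ.≤ term Q? x ℕ.+ term R? x
    term-≤ with P? x | Q? x | R? x
    ... | no _  | _     | _     = z≤n
    ... | yes _ | yes _ | _     = ℕ.m≤m+n _ _
    ... | yes _ | no _  | yes _ = ℕ.≤-refl
    ... | yes p | no ¬q | no ¬r = contradiction (P⊆Q∪R p) Sum.[ ¬q , ¬r ]

⊆-⋃ : ∀ {n} {p : Subset n} {ps} → p ∈ₗ ps → p ⊆ ⋃ ps
⊆-⋃ {ps = p ∷ ps} (here refl) = p⊆p∪q (⋃ ps)
⊆-⋃ {ps = p ∷ ps} (there i)   = q⊆p∪q p (⋃ ps) ∘ ⊆-⋃ i

⋃-least : ∀ {n} {q : Subset n} ps → (∀ {p} → p ∈ₗ ps → p ⊆ q) → ⋃ ps ⊆ q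
⋃-least []       h x = contradiction x ∉⊥
⋃-least (p ∷ ps) h x with x∈p∪q⁻ p (⋃ ps) x
... | inj₁ x∈p = h (here refl) x∈p
... | inj₂ x∈⋃ = ⋃-least ps (h ∘ there) x∈⋃

-- Rational inequalities as inequalities of naturals.

-- The fraction need not be reduced, so numerators and denominators can be tracked as plain products
-- although `ℚ` normalises.
record IsRatio (p : ℚ) (a b : ℕ) : Set where
  constructor _,_
  field
    denominator≢0 : NonZero b
    equation      : p ≡ _/_ (+ a) b {{denominator≢0}}

toℚᵘ-/ : ∀ a b → toℚᵘ (+ a / suc b) ℚᵘ.≃ mkℚᵘ (+ a) b
toℚᵘ-/ a b = ℚ.toℚᵘ-fromℚᵘ (mkℚᵘ (+ a) b)

ratio-* : ∀ {p q a b c d} → IsRatio p a b → IsRatio q c d → IsRatio (p * q) (a ℕ.* c) (b ℕ.* d)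
ratio-* {a = a} {b = suc b} {c} {suc d} (_ , refl) (_ , refl) = _ , ℚ.toℚᵘ-injective (begin
  toℚᵘ (+ a / suc b * (+ c / suc d))               ≈⟨ ℚ.toℚᵘ-homo-* (+ a / suc b) (+ c / suc d) ⟩
  toℚᵘ (+ a / suc b) ℚᵘ.* toℚᵘ (+ c / suc d)       ≈⟨ ℚᵘ.*-cong (toℚᵘ-/ a b) (toℚᵘ-/ c d) ⟩
  -- `mkℚᵘ` stores the denominator minus one, and `suc (d + b * suc d)` is `suc b * suc d`.
  mkℚᵘ (+ a) b ℚᵘ.* mkℚᵘ (+ c) d                   ≡⟨ cong (λ z → mkℚᵘ z (d ℕ.+ b ℕ.* suc d)) (ℤ.pos-* a c) ⟨
  mkℚᵘ (+ (a ℕ.* c)) (d ℕ.+ b ℕ.* suc d)           ≈⟨ toℚᵘ-/ (a ℕ.* c) (d ℕ.+ b ℕ.* suc d) ⟨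
  toℚᵘ (+ (a ℕ.* c) / (suc b ℕ.* suc d))           ∎)
  where open import Relation.Binary.Reasoning.Setoid ℚᵘ.≃-setoid

ratio-≤⁻ : ∀ {p q a b c d} → IsRatio p a b → IsRatio q c d → p ≤ q → a ℕ.* d ℕ.≤ c ℕ.* b
ratio-≤⁻ {a = a} {b = suc b} {c} {suc d} (_ , refl) (_ , refl) p≤q
  with ℚᵘ.≤-respˡ-≃ (toℚᵘ-/ a b) (ℚᵘ.≤-respʳ-≃ (toℚᵘ-/ c d) (ℚ.toℚᵘ-mono-≤ p≤q))
... | *≤* le = ℤ.drop‿+≤+ (begin
  + (a ℕ.* suc d)     ≡⟨ ℤ.pos-* a (suc d) ⟩
  + a ℤ.* + suc d     ≤⟨ le ⟩
  + c ℤ.* + suc b     ≡⟨ ℤ.pos-* c (suc b) ⟨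
  + (c ℕ.* suc b)     ∎)
  where open ℤ.≤-Reasoning

ratio-≤⁺ : ∀ {p q a b c d} → IsRatio p a b → IsRatio q c d → a ℕ.* d ℕ.≤ c ℕ.* b → p ≤ q
ratio-≤⁺ {a = a} {b = suc b} {c} {suc d} (_ , refl) (_ , refl) ad≤cb =
  ℚ.toℚᵘ-cancel-≤ (ℚᵘ.≤-respˡ-≃ (ℚᵘ.≃-sym (toℚᵘ-/ a b)) (ℚᵘ.≤-respʳ-≃ (ℚᵘ.≃-sym (toℚᵘ-/ c d)) (*≤* (begin
  + a ℤ.* + suc d     ≡⟨ ℤ.pos-* a (suc d) ⟨
  + (a ℕ.* suc d)     ≤⟨ ℤ.+≤+ ad≤cb ⟩
  + (c ℕ.* suc b)     ≡⟨ ℤ.pos-* c (suc b) ⟩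
  + c ℤ.* + suc b     ∎))))
  where open ℤ.≤-Reasoning

-- Updates of partial schedules.

update-view : ∀ {A : Set} {n} (s : Vec A n) {i j x y} → lookup (s [ i ]≔ x) j ≡ y →
              (i ≡ j × x ≡ y) ⊎ lookup s j ≡ y
update-view s {i} {j} {x} eq with i Fin.≟ j
... | yes refl = inj₁ (refl , trans (sym (lookup∘update i s x)) eq)
... | no i≢j   = inj₂ (trans (sym (lookup∘update′ (i≢j ∘ sym) s x)) eq)

-- Runs fill only vacant entries, so facts about sets already placed survive every later step.
update-keep : ∀ {A : Set} {n} (s : Vec (Maybe A) n) {i j x q} →
              lookup s i ≡ nothing → lookup s j ≡ just q → lookup (s [ i ]≔ x) j ≡ just q
update-keep s {i} {j} {x} vacant eq with i Fin.≟ j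
... | yes refl = contradiction (trans (sym vacant) eq) λ ()
... | no i≢j   = trans (lookup∘update′ (i≢j ∘ sym) s x) eq

-- Termination measure of list-scheduling.
vacancies : ∀ {A : Set} {n} → Vec (Maybe A) n → ℕ
vacancies []            = 0
vacancies (nothing ∷ s) = suc (vacancies s)
vacancies (just _  ∷ s) = vacancies s

vacancies-fill : ∀ {A : Set} {n} (s : Vec (Maybe A) n) i {x} → lookup s i ≡ nothing →
                 vacancies s ≡ suc (vacancies (s [ i ]≔ just x))
vacancies-fill (nothing ∷ s) zero    _  = refl
vacancies-fill (nothing ∷ s) (suc i) eq = cong suc (vacancies-fill s i eq)
vacancies-fill (just _  ∷ s) (suc i) eq = vacancies-fill s i eq

-- Maxima over the rationals, the choice of a layer and the final arithmetic.

private
  module ℚ-Extrema = Data.List.Extrema (DecTotalOrder.totalOrder ℚ.≤-decTotalOrder)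

-- The layer bound is the minimum of `d` and `L`. It is written `suc (toℕ a)`, so after both
-- arguments are split as successors, `a` stands for the minimum of their predecessors.
layer-index : ∀ {d L} → 1 ℕ.≤ d → 1 ℕ.≤ L →
              ∃ λ (a : Fin d) → suc (toℕ a) ℕ.≤ L × (∀ {x} → x ℕ.≤ d → x ℕ.≤ L → x ℕ.≤ suc (toℕ a))
layer-index {suc d} {suc L} _ _ = fromℕ< a<d ,
  subst (λ x → suc x ℕ.≤ suc L) (sym (toℕ-fromℕ< a<d)) (s≤s (ℕ.m⊓n≤n d L)) ,
  λ {x} x≤d x≤L → subst (λ y → x ℕ.≤ suc y) (sym (toℕ-fromℕ< a<d)) (ℕ.⊓-glb x≤d x≤L)
  where
  a<d : d ⊓ L ℕ.< suc d
  a<d = s≤s (ℕ.m⊓n≤m d L)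

-- With X = W Q and Y = P L the hypotheses give X² ≤ 4 k Y² and X ≤ 2 k Y.
-- The factors 1 are the denominators of the rationals 2 and k in the theorem.
cubic-bound : ∀ {m k T W L P Q} → 1 ℕ.≤ m ℕ.* L → T ℕ.≤ k → T ℕ.≤ m ℕ.* L →
              m ℕ.* (W ℕ.* Q) ℕ.≤ P ℕ.* (m ℕ.* L ℕ.+ k) → W ℕ.* Q ℕ.≤ T ℕ.* (P ℕ.* (2 ℕ.* L)) →
              W ℕ.* W ℕ.* W ℕ.* (1 ℕ.* 1 ℕ.* 1 ℕ.* (1 ℕ.* 1) ℕ.* (Q ℕ.* Q ℕ.* Q)) ℕ.≤
              2 ℕ.* 2 ℕ.* 2 ℕ.* (k ℕ.* k) ℕ.* (P ℕ.* P ℕ.* P) ℕ.* (L ℕ.* L ℕ.* L)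
cubic-bound {m} {k} {T} {W} {L} {P} {Q} mL≥1 T≤k T≤mL layer cone = begin
  W ℕ.* W ℕ.* W ℕ.* (1 ℕ.* 1 ℕ.* 1 ℕ.* (1 ℕ.* 1) ℕ.* (Q ℕ.* Q ℕ.* Q))             ≡⟨ lhs W Q ⟩
  X ℕ.* X ℕ.* X                                                             ≤⟨ ℕ.*-mono-≤ square linear ⟩
  4 ℕ.* k ℕ.* Y ℕ.* Y ℕ.* (2 ℕ.* k ℕ.* Y)                                   ≡⟨ rhs k P L ⟩
  2 ℕ.* 2 ℕ.* 2 ℕ.* (k ℕ.* k) ℕ.* (P ℕ.* P ℕ.* P) ℕ.* (L ℕ.* L ℕ.* L)       ∎
  where
  open ℕ.≤-Reasoning
  X = W ℕ.* Q
  Y = P ℕ.* L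

  lhs : ∀ W Q → W ℕ.* W ℕ.* W ℕ.* (1 ℕ.* 1 ℕ.* 1 ℕ.* (1 ℕ.* 1) ℕ.* (Q ℕ.* Q ℕ.* Q)) ≡
                (W ℕ.* Q) ℕ.* (W ℕ.* Q) ℕ.* (W ℕ.* Q)
  lhs = solve-∀

  rhs : ∀ k P L → 4 ℕ.* k ℕ.* (P ℕ.* L) ℕ.* (P ℕ.* L) ℕ.* (2 ℕ.* k ℕ.* (P ℕ.* L)) ≡
                  2 ℕ.* 2 ℕ.* 2 ℕ.* (k ℕ.* k) ℕ.* (P ℕ.* P ℕ.* P) ℕ.* (L ℕ.* L ℕ.* L)
  rhs = solve-∀

  linear : X ℕ.≤ 2 ℕ.* k ℕ.* Y
  linear = begin
    X                               ≤⟨ cone ⟩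
    T ℕ.* (P ℕ.* (2 ℕ.* L))         ≤⟨ ℕ.*-monoˡ-≤ (P ℕ.* (2 ℕ.* L)) T≤k ⟩
    k ℕ.* (P ℕ.* (2 ℕ.* L))         ≡⟨ regroup k P L ⟩
    2 ℕ.* k ℕ.* Y                   ∎
    where
    regroup : ∀ k P L → k ℕ.* (P ℕ.* (2 ℕ.* L)) ≡ 2 ℕ.* k ℕ.* (P ℕ.* L)
    regroup = solve-∀

  square : X ℕ.* X ℕ.≤ 4 ℕ.* k ℕ.* Y ℕ.* Y
  square = ℕ.*-cancelʳ-≤ _ _ (m ℕ.* L) {{ℕ.>-nonZero mL≥1}} (begin
    X ℕ.* X ℕ.* (m ℕ.* L)                                               ≡⟨ regroup₁ X m L ⟩
    X ℕ.* (m ℕ.* X) ℕ.* L                                               ≤⟨ ℕ.*-monoˡ-≤ L (ℕ.*-mono-≤ cone layer) ⟩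
    T ℕ.* (P ℕ.* (2 ℕ.* L)) ℕ.* (P ℕ.* (m ℕ.* L ℕ.+ k)) ℕ.* L           ≡⟨ regroup₂ T P L m k ⟩
    -- `T` is bounded by `k` in the first summand and by `m * L` in the second. Both become
    -- `k * (m * L)`, which lets `m * L` cancel.
    2 ℕ.* Y ℕ.* Y ℕ.* (T ℕ.* (m ℕ.* L) ℕ.+ T ℕ.* k)                     ≤⟨ ℕ.*-monoʳ-≤ (2 ℕ.* Y ℕ.* Y)
                                                                             (ℕ.+-mono-≤ (ℕ.*-monoˡ-≤ (m ℕ.* L) T≤k) (ℕ.*-monoˡ-≤ k T≤mL)) ⟩
    2 ℕ.* Y ℕ.* Y ℕ.* (k ℕ.* (m ℕ.* L) ℕ.+ m ℕ.* L ℕ.* k)               ≡⟨ regroup₃ Y k (m ℕ.* L) ⟩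
    4 ℕ.* k ℕ.* Y ℕ.* Y ℕ.* (m ℕ.* L)                                   ∎)
    where
    regroup₁ : ∀ X m L → X ℕ.* X ℕ.* (m ℕ.* L) ≡ X ℕ.* (m ℕ.* X) ℕ.* L
    regroup₁ = solve-∀
    regroup₂ : ∀ T P L m k → T ℕ.* (P ℕ.* (2 ℕ.* L)) ℕ.* (P ℕ.* (m ℕ.* L ℕ.+ k)) ℕ.* L ≡
                             2 ℕ.* (P ℕ.* L) ℕ.* (P ℕ.* L) ℕ.* (T ℕ.* (m ℕ.* L) ℕ.+ T ℕ.* k)
    regroup₂ = solve-∀
    regroup₃ : ∀ Y k M → 2 ℕ.* Y ℕ.* Y ℕ.* (k ℕ.* M ℕ.+ M ℕ.* k) ≡ 4 ℕ.* k ℕ.* Y ℕ.* Y ℕ.* M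
    regroup₃ = solve-∀

-- Precedence, depth and decidability.

module _ (I : Instance) where
  open Instance I
  open Assignment

  private
    _≺_ = Predecessor I

  -- `TransClosure` unfolds at the first edge, whereas recursion on the target `i` needs the last
  -- one.
  ≺-split : ∀ {j i} → j ≺ i → j ⟶ i ⊎ ∃ λ l → l ⟶ i × j ≺ l
  ≺-split [ e ]   = inj₁ e
  ≺-split (e ∷ p) with ≺-split p
  ... | inj₁ e′           = inj₂ (_ , e′ , [ e ])
  ... | inj₂ (l , e′ , q) = inj₂ (l , e′ , e ∷ q)

  _≺?_ : ∀ j i → Dec (j ≺ i)
  j ≺? i = go i (predecessor-wellFounded I i)
    where
    go : ∀ i → Acc _≺_ i → Dec (j ≺ i)
    go i (acc rs) = map′ Sum.[ [_] , (λ (_ , e , p) → p ∷ʳ e) ] ≺-split ((j ⟶? i) ⊎-dec any? via)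
      where
      via : ∀ l → Dec (l ⟶ i × j ≺ l)
      -- The edge is tested first because it supplies the accessibility of `l` for the recursive
      -- call.
      via l with l ⟶? i
      ... | no ¬e = no (¬e ∘ proj₁)
      ... | yes e = map′ (e ,_) proj₂ (go l (rs [ e ]))

  path-extend : ∀ {j i l} → PathTo I j l → j ≺ i → ∃ λ l′ → PathTo I i l′ × l ℕ.< l′
  path-extend p [ e ]   = _ , p ▻ e , ℕ.≤-refl
  path-extend p (e ∷ q) = Product.map₂ (Product.map₂ ℕ.<⇒≤) (path-extend (p ▻ e) q)

  -- A longest path to `j` extends to a longer one ending at `i`.
  depth-≺ : ∀ {j i} → j ≺ i → depth I j ℕ.< depth I i
  depth-≺ {j} {i} j≺i with path-extend (proj₁ (proj₂ (depth-exists I j))) j≺i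
  ... | l , p , lt = ℕ.<-≤-trans lt (proj₂ (proj₂ (depth-exists I i)) l p)

  depth-positive : ∀ i → 1 ℕ.≤ depth I i
  depth-positive i = proj₂ (proj₂ (depth-exists I i)) 1 (start i)

  _≟ₛ_ : ∀ (x y : Maybe (Fin m × ℕ)) → Dec (x ≡ y)
  _≟ₛ_ = ≡-dec (Product.≡-dec Fin._≟_ ℕ._≟_)

  completedBy? : ∀ s t i → Dec (CompletedBy I s t i)
  completedBy? s t i with lookup s i
  ... | nothing       = no λ ()
  ... | just (μ , t′) = map′ (λ le → μ , t′ , refl , le) (λ { (_ , _ , refl , le) → le }) (suc t′ ℕ.≤? t)

  available? : ∀ s i μ t → Dec (Available I s i μ t)
  available? s i μ t = all? (λ j → ¬? (lookup s j ≟ₛ just (μ , t)))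
                ×-dec all? (λ j → (j ≺? i) →-dec completedBy? s t j)

  completedBy-update : ∀ {s t i j x} → lookup s i ≡ nothing →
                       CompletedBy I s t j → CompletedBy I (s [ i ]≔ x) t j
  completedBy-update {s} vacant (μ , t′ , eq , le) = μ , t′ , update-keep s vacant eq , le

  -- The maximum from `duration`, but for bare slots: a run may still be empty and is then no
  -- `Assignment`. On `slots F` the two agree by definition.
  horizon : Slots I → ℕ
  horizon s = max 0 (map (λ i → completion I (lookup s i)) (allFin k))

  completion≤horizon : ∀ s {i μ t} → lookup s i ≡ just (μ , t) → suc t ℕ.≤ horizon s
  completion≤horizon s {i} eq = subst (λ p → completion I p ℕ.≤ horizon s) eq
    (All.lookup (xs≤max 0 (map _ (allFin k))) (∈-map⁺ (λ i → completion I (lookup s i)) (∈-allFin i)))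

  -- Existence of list schedules

  PredecessorClosed : Pred (Fin k) 0ℓ → Set
  PredecessorClosed 𝒯 = ∀ {j i} → j ≺ i → 𝒯 i → 𝒯 j

  module _ {𝒯 : Pred (Fin k) 0ℓ} (𝒯? : Decidable 𝒯) (closed : PredecessorClosed 𝒯) where

    Waiting : Slots I → Pred (Fin k) 0ℓ
    Waiting s i = 𝒯 i × lookup s i ≡ nothing

    -- From the horizon on, every machine is idle. A predecessor of `i` lies in `𝒯` and has smaller
    -- depth, so by the choice of `i` it is not waiting; hence it is scheduled and completed by
    -- then.
    available-somewhere : ∀ s {i} → Waiting s i → (∀ j → Waiting s j → depth I i ℕ.≤ depth I j) →
                          ∃ λ μ → Available I s i μ (horizon s)
    available-somewhere s {i} (𝒯i , _) shallowest = fromℕ< m≥1 , free , completed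
      where
      free : ∀ j → lookup s j ≢ just (fromℕ< m≥1 , horizon s)
      free j eq = ℕ.<-irrefl refl (completion≤horizon s eq)
      completed : ∀ j → j ≺ i → CompletedBy I s (horizon s) j
      completed j j≺i with lookup s j in eq
      ... | just (μ , t) = μ , t , refl , completion≤horizon s eq
      ... | nothing      = contradiction (shallowest j (closed j≺i 𝒯i , eq)) (ℕ.<⇒≱ (depth-≺ j≺i))

    advance : ∀ {s} → ListRun I 𝒯 s → ∃ (Waiting s) →
              ∃ λ s′ → ListRun I 𝒯 s′ × vacancies s ≡ suc (vacancies s′)
    advance {s} run waiting =
      let i , (𝒯i , vacant) , shallowest = minimiser (λ i → 𝒯? i ×-dec (lookup s i ≟ₛ nothing)) (depth I) waiting
          -- Minimising over the times at which some machine is available gives minimality over all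
          -- machines at once; the horizon bounds the search.
          t , (μ , avail) , earliest     = least (λ t → any? (λ μ → available? s i μ t)) (horizon s)
                                             (available-somewhere s (𝒯i , vacant) shallowest)
      in s [ i ]≔ just (μ , t) ,
         step i μ t run 𝒯i vacant (λ j 𝒯j v → shallowest j (𝒯j , v)) avail (λ μ′ t′ a → earliest t′ (μ′ , a)) ,
         vacancies-fill s i vacant

    complete-run : ∀ n {s} → vacancies s ≡ n → ListRun I 𝒯 s →
                   ∃ λ s′ → ListRun I 𝒯 s′ × (∀ i → 𝒯 i → Scheduled I s′ i)
    complete-run n {s} count run with any? (λ i → 𝒯? i ×-dec (lookup s i ≟ₛ nothing))
    ... | no none = s , run , scheduled
      where
      scheduled : ∀ i → 𝒯 i → Scheduled I s i
      scheduled i 𝒯i with lookup s i in eq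
      ... | just p  = p , refl
      ... | nothing = contradiction (i , 𝒯i , eq) none
    ... | yes waiting = continue n count (advance run waiting)
      where
      continue : ∀ n → vacancies s ≡ n → ∃ (λ s′ → ListRun I 𝒯 s′ × vacancies s ≡ suc (vacancies s′)) →
                 ∃ λ s′ → ListRun I 𝒯 s′ × (∀ i → 𝒯 i → Scheduled I s′ i)
      continue zero    count (_ , _ , fewer)     = contradiction (trans (sym count) fewer) λ ()
      continue (suc n) count (s′ , run′ , fewer) =
        complete-run n (ℕ.suc-injective (trans (sym fewer) count)) run′

  -- Invariants of list-scheduling runs

  Full : Slots I → ℕ → Set
  Full s u = ∀ μ → ∃ λ j → lookup s j ≡ just (μ , u)

  -- The condition `u ≤ t` says that the predecessor finishes only after time `u`, so `i` cannot
  -- start at `u`.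
  Blocked : Slots I → Fin k → ℕ → Set
  Blocked s i u = ∃ λ j → j ≺ i × ∃₂ λ ν t → lookup s j ≡ just (ν , t) × u ℕ.≤ t

  module _ {𝒯 : Pred (Fin k) 0ℓ} where

    run-family : ∀ {s i p} → ListRun I 𝒯 s → lookup s i ≡ just p → 𝒯 i
    run-family {i = i} empty eq = contradiction (trans (sym (lookup-replicate i nothing)) eq) λ ()
    run-family (step {s} i μ t run 𝒯i vacant _ _ _) eq with update-view s eq
    ... | inj₁ (refl , _) = 𝒯i
    ... | inj₂ old        = run-family run old

    run-conflictFree : ∀ {s i j p} → ListRun I 𝒯 s → lookup s i ≡ just p → lookup s j ≡ just p → i ≡ j
    run-conflictFree {i = i} empty eq = contradiction (trans (sym (lookup-replicate i nothing)) eq) λ ()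
    run-conflictFree (step {s} i μ t run _ vacant _ (free , _) _) eq₁ eq₂
      with update-view s eq₁ | update-view s eq₂
    ... | inj₁ (refl , _)    | inj₁ (refl , _)    = refl
    ... | inj₁ (refl , refl) | inj₂ old           = contradiction old (free _)
    ... | inj₂ old           | inj₁ (refl , refl) = contradiction old (free _)
    ... | inj₂ old₁          | inj₂ old₂          = run-conflictFree run old₁ old₂

    run-closed : ∀ {s i μ t} → ListRun I 𝒯 s → lookup s i ≡ just (μ , t) →
                 ∀ j → j ≺ i → CompletedBy I s t j
    run-closed {i = i} empty eq = contradiction (trans (sym (lookup-replicate i nothing)) eq) λ ()
    run-closed (step {s} i μ t run _ vacant _ (_ , completed) _) eq j j≺i with update-view s eq
    ... | inj₁ (refl , refl) = completedBy-update {s} vacant (completed j j≺i)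
    ... | inj₂ old           = completedBy-update {s} vacant (run-closed run old j j≺i)

    run-greedy : ∀ {s i μ t u} → ListRun I 𝒯 s → lookup s i ≡ just (μ , t) → u ℕ.< t →
                 Full s u ⊎ Blocked s i u
    run-greedy {i = i} empty eq = contradiction (trans (sym (lookup-replicate i nothing)) eq) λ ()
    run-greedy {u = u} (step {s} i μ t run _ vacant _ (_ , completed) earliest) eq u<t
      with update-view s eq
    ... | inj₂ old = Sum.map (λ full μ′ → Product.map₂ (update-keep s vacant) (full μ′))
        (λ (j , j≺i , ν , t′ , e , le) → j , j≺i , ν , t′ , update-keep s vacant e , le)
        (run-greedy run old u<t)
    ... | inj₁ (refl , refl) with any? (λ j → (j ≺? i) ×-dec ¬? (completedBy? s u j))
    ... | yes (j , j≺i , ¬done) with completed j j≺i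
    ... | ν , t′ , e , _ = inj₂ (j , j≺i , ν , t′ , update-keep s vacant e ,
                                 ℕ.≤-pred (ℕ.≰⇒> λ le → ¬done (ν , t′ , e , le)))
    run-greedy {u = u} (step {s} i μ t run _ vacant _ _ earliest) eq u<t
        | inj₁ (refl , refl) | no unblocked = inj₁ full
      where
      done : ∀ j → j ≺ i → CompletedBy I s u j
      done j j≺i = decidable-stable (completedBy? s u j) λ ¬done → unblocked (j , j≺i , ¬done)
      full : ∀ μ′ → ∃ λ j → lookup (s [ i ]≔ just (μ , t)) j ≡ just (μ′ , u)
      full μ′ with any? (λ j → lookup s j ≟ₛ just (μ′ , u))
      ... | yes (j , e) = j , update-keep s vacant e
      ... | no idle     = contradiction (earliest μ′ u ((λ j e → idle (j , e)) , done)) (ℕ.<⇒≱ u<t)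

    -- Graham's chain, by induction on `u`. The slot just before `u` is either full and joins `ts`,
    -- or it blocks `i`; then the argument continues with a blocking predecessor, whose smaller
    -- depth pays for the slot. Thus at most `depth I i - 1` of the slots before `u` are left out of
    -- `ts`. Allowing `u ≤ t` lets the induction pass to a predecessor that starts at `u` or later.
    full-slots : ∀ {s} → ListRun I 𝒯 s → ∀ u {i μ t} → lookup s i ≡ just (μ , t) → u ℕ.≤ t →
                 ∃ λ ts → Unique ts × All (λ v → v ℕ.< u × Full s v) ts × suc u ℕ.≤ depth I i ℕ.+ length ts
    full-slots run zero {i} eq _ = [] , [] , [] , ℕ.m≤n⇒m≤n+o 0 (depth-positive i)
    full-slots run (suc u) {i} eq u<t with run-greedy run eq u<t
    ... | inj₁ full with ts , unique , fulls , le ← full-slots run u eq (ℕ.<⇒≤ u<t) =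
      u ∷ ts ,
      All.map (λ (v<u , _) → ℕ.<⇒≢ v<u ∘ sym) fulls ∷ unique ,
      (ℕ.≤-refl , full) ∷ All.map (Product.map₁ ℕ.m≤n⇒m≤1+n) fulls ,
      subst (suc (suc u) ℕ.≤_) (sym (ℕ.+-suc (depth I i) (length ts))) (s≤s le)
    ... | inj₂ (j , j≺i , ν , t′ , eq′ , u≤t′) with ts , unique , fulls , le ← full-slots run u eq′ u≤t′ =
      ts , unique , All.map (Product.map₁ ℕ.m≤n⇒m≤1+n) fulls ,
      ℕ.≤-trans (s≤s le) (ℕ.+-monoˡ-≤ (length ts) (depth-≺ j≺i))

  -- The `m * length ts` cells in full slots hold pairwise different sets, since `lookup` puts a set
  -- into one cell only.
  full-slots-bound : ∀ {s ts} {ys : List (Fin k)} → (∀ {i p} → lookup s i ≡ just p → i ∈ₗ ys) →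
                     Unique ts → All (Full s) ts → m ℕ.* length ts ℕ.≤ length ys
  full-slots-bound {s} {ts} {ys} ⊆ys unique fulls = begin
    m ℕ.* length ts                          ≡⟨ cong (ℕ._* length ts) (length-allFin m) ⟨
    length (allFin m) ℕ.* length ts          ≡⟨ length-cartesianProduct (allFin m) ts ⟨
    length (cartesianProduct (allFin m) ts)  ≤⟨ length-injection (λ p j → lookup s j ≡ just p)
                                                  (Unique.cartesianProduct⁺ (Unique.allFin⁺ m) unique) image
                                                  (λ e e′ → just-injective (trans (sym e) e′)) ⟩
    length ys                                ∎
    where
    open ℕ.≤-Reasoning
    image : ∀ {p} → p ∈ₗ cartesianProduct (allFin m) ts → ∃ λ j → j ∈ₗ ys × lookup s j ≡ just p
    image {μ , t} p∈ with ∈-cartesianProduct⁻ (allFin m) ts p∈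
    ... | _ , t∈ts with j , eq ← All.lookup fulls t∈ts μ = j , ⊆ys eq , eq

  -- Graham's bound: at each time a set is either waiting for one of its
  -- predecessors or all machines are busy.
  list-duration : ∀ {𝒯 H} {ys : List (Fin k)} F → ListRun I 𝒯 (slots F) →
                  (∀ {i} → 𝒯 i → depth I i ℕ.≤ H) → (∀ {i} → 𝒯 i → i ∈ₗ ys) →
                  m ℕ.* duration I F ℕ.≤ m ℕ.* H ℕ.+ length ys
  list-duration {H = H} {ys} F run shallow ⊆ys =
    -- `max` is the `argmax` of the identity, so the bound is checked for the default `0` and for
    -- each completion time.
    argmax-all (λ x → x) {P = λ x → m ℕ.* x ℕ.≤ m ℕ.* H ℕ.+ length ys}
      nothing-≤ (All.map⁺ (All.tabulate {xs = allFin k} λ {i} _ → bound i))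
    where
    nothing-≤ : m ℕ.* 0 ℕ.≤ m ℕ.* H ℕ.+ length ys
    nothing-≤ = subst (λ x → x ℕ.≤ m ℕ.* H ℕ.+ length ys) (sym (ℕ.*-zeroʳ m)) z≤n
    bound : ∀ i → m ℕ.* completion I (lookup (slots F) i) ℕ.≤ m ℕ.* H ℕ.+ length ys
    bound i with lookup (slots F) i in eq
    ... | nothing = nothing-≤
    ... | just (μ , t) with ts , unique , fulls , le ← full-slots run t eq ℕ.≤-refl = begin
      m ℕ.* suc t                             ≤⟨ ℕ.*-monoʳ-≤ m le ⟩
      m ℕ.* (depth I i ℕ.+ length ts)         ≡⟨ ℕ.*-distribˡ-+ m (depth I i) (length ts) ⟩
      m ℕ.* depth I i ℕ.+ m ℕ.* length ts     ≤⟨ ℕ.+-mono-≤ (ℕ.*-monoʳ-≤ m (shallow (run-family run eq)))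
                                                   (full-slots-bound {s = slots F} (⊆ys ∘ run-family run) unique
                                                     (All.map proj₂ fulls)) ⟩
      m ℕ.* H ℕ.+ length ys                   ∎
      where open ℕ.≤-Reasoning

  listSchedule : ∀ {𝒯} → Decidable 𝒯 → PredecessorClosed 𝒯 → ∃ 𝒯 → ∃ (ListScheduling I 𝒯)
  listSchedule 𝒯? closed (i , 𝒯i) with complete-run 𝒯? closed _ refl empty
  ... | s , run , scheduled = record
    { slots        = s
    ; conflictFree = run-conflictFree run
    ; nonempty     = i , scheduled i 𝒯i
    } , run , scheduled

  -- Weights and densities

  weight-∪ : ∀ U V → weight I (U ∪ V) ℕ.≤ weight I U ℕ.+ weight I V
  weight-∪ U V = sum-filter-∪ (_∈? (U ∪ V)) (_∈? U) (_∈? V) w (x∈p∪q⁻ U V) (allFin n)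

  weight-⊥ : weight I ⊥ ≡ 0
  weight-⊥ = cong (sum ∘ map w) (filter-none (_∈? ⊥) (All.tabulate {xs = allFin n} λ _ → ∉⊥))

  weight-mono : ∀ {U V} → U ⊆ V → weight I U ℕ.≤ weight I V
  weight-mono {U} {V} U⊆V = begin
    weight I U                   ≤⟨ sum-filter-∪ (_∈? U) (_∈? V) (_∈? ⊥) w (inj₁ ∘ U⊆V) (allFin n) ⟩
    weight I V ℕ.+ weight I ⊥    ≡⟨ cong (weight I V ℕ.+_) weight-⊥ ⟩
    weight I V ℕ.+ 0             ≡⟨ ℕ.+-identityʳ (weight I V) ⟩
    weight I V                   ∎
    where open ℕ.≤-Reasoning

  -- Union bound in cross-multiplied form: `q` takes the denominator of the density with which each
  -- weight is compared.
  weight-⋃ : ∀ {q b} is → (∀ {i} → i ∈ₗ is → weight I (sets i) ℕ.* q ℕ.≤ b) →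
             weight I (⋃ (map sets is)) ℕ.* q ℕ.≤ length is ℕ.* b
  weight-⋃ {q} []       bound = ℕ.≤-reflexive (cong (ℕ._* q) weight-⊥)
  weight-⋃ {q} {b} (i ∷ is) bound = begin
    weight I (sets i ∪ rest) ℕ.* q                            ≤⟨ ℕ.*-monoˡ-≤ q (weight-∪ (sets i) rest) ⟩
    (weight I (sets i) ℕ.+ weight I rest) ℕ.* q               ≡⟨ ℕ.*-distribʳ-+ q (weight I (sets i)) (weight I rest) ⟩
    weight I (sets i) ℕ.* q ℕ.+ weight I rest ℕ.* q           ≤⟨ ℕ.+-mono-≤ (bound (here refl)) (weight-⋃ is (bound ∘ there)) ⟩
    b ℕ.+ length is ℕ.* b                                     ∎
    where
    open ℕ.≤-Reasoning
    rest = ⋃ (map sets is)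

  -- The index list inside `cov`, so that `cov I F` unfolds to `⋃ (map sets (scheduled F))`.
  scheduled : Assignment I → List (Fin k)
  scheduled F = filterᵇ (λ i → is-just (lookup (slots F) i)) (allFin k)

  ∈-scheduled⁺ : ∀ F {i} → Scheduled I (slots F) i → i ∈ₗ scheduled F
  ∈-scheduled⁺ F {i} (_ , eq) = ∈-filter⁺ (λ i → T? (is-just (lookup (slots F) i))) (∈-allFin i)
    (subst (T ∘ is-just) (sym eq) _)

  ∈-scheduled⁻ : ∀ F {i} → i ∈ₗ scheduled F → Scheduled I (slots F) i
  ∈-scheduled⁻ F {i} i∈ with lookup (slots F) i | proj₂ (∈-filter⁻ (λ i → T? (is-just (lookup (slots F) i))) {xs = allFin k} i∈)
  ... | just p | _ = p , refl

  sets⊆cov : ∀ F {i} → Scheduled I (slots F) i → sets i ⊆ cov I F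
  sets⊆cov F s = ⊆-⋃ (∈-map⁺ sets (∈-scheduled⁺ F s))

  cov-mono : ∀ F F′ → (∀ {i} → Scheduled I (slots F) i → Scheduled I (slots F′) i) → cov I F ⊆ cov I F′
  cov-mono F F′ h = ⋃-least (map sets (scheduled F)) λ p∈ → case ∈-map⁻ sets p∈ of λ where
    (i , i∈ , refl) → sets⊆cov F′ (h (∈-scheduled⁻ F i∈))

  scheduled≤k : ∀ F → length (scheduled F) ℕ.≤ k
  scheduled≤k F = ℕ.≤-trans (length-filter _ (allFin k)) (ℕ.≤-reflexive (length-allFin k))

  -- By `conflictFree`, scheduled sets occupy different cells of the grid of `m` machines and
  -- `duration I F` slots.
  scheduled≤m*duration : ∀ F → length (scheduled F) ℕ.≤ m ℕ.* duration I F
  scheduled≤m*duration F = begin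
    length (scheduled F)                        ≤⟨ length-injection (λ i p → lookup (slots F) i ≡ just p)
                                                     (Unique.filter⁺ _ (Unique.allFin⁺ k)) image (conflictFree F) ⟩
    length (cartesianProduct (allFin m) times)  ≡⟨ length-cartesianProduct (allFin m) times ⟩
    length (allFin m) ℕ.* length times          ≡⟨ cong₂ ℕ._*_ (length-allFin m) (length-upTo (duration I F)) ⟩
    m ℕ.* duration I F                          ∎
    where
    open ℕ.≤-Reasoning
    times = upTo (duration I F)
    image : ∀ {i} → i ∈ₗ scheduled F →
            ∃ λ p → p ∈ₗ cartesianProduct (allFin m) times × lookup (slots F) i ≡ just p
    image i∈ with (μ , t) , eq ← ∈-scheduled⁻ F i∈ =
      (μ , t) , ∈-cartesianProduct⁺ (∈-allFin μ) (∈-upTo⁺ (completion≤horizon (slots F) eq)) , eq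

  -- The sets along a path are completed one after another, each taking a unit of time.
  path≤completion : ∀ {F i μ t l} → PrecedenceClosed I F → lookup (slots F) i ≡ just (μ , t) →
                    PathTo I i l → l ℕ.≤ suc t
  path≤completion closed eq (start _)         = s≤s z≤n
  path≤completion {F} closed eq (_▻_ {j = j} p e) with _ , _ , eq′ , le ← closed eq j [ e ] =
    s≤s (ℕ.≤-trans (path≤completion {F} closed eq′ p) le)

  depth≤duration : ∀ {F i} → PrecedenceClosed I F → Scheduled I (slots F) i → depth I i ℕ.≤ duration I F
  depth≤duration {F} {i} closed (_ , eq) = ℕ.≤-trans
    (path≤completion {F} closed eq (proj₁ (proj₂ (depth-exists I i)))) (completion≤horizon (slots F) eq)

  depth≤maxDepth : ∀ i → depth I i ℕ.≤ maxDepth I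
  depth≤maxDepth i = All.lookup (xs≤max 0 (map (depth I) (allFin k))) (∈-map⁺ (depth I) (∈-allFin i))

  firstSet : Fin k
  firstSet = fromℕ< k≥1

  density-ratio : ∀ F → IsRatio (density I F) (weight I (cov I F)) (duration I F)
  density-ratio F = duration-nonZero I F , refl

  listScheduling-closed : ∀ {𝒯} F → ListScheduling I 𝒯 F → PrecedenceClosed I F
  listScheduling-closed F (run , _) = run-closed run

  precDense-closed : ∀ F → PrecDense I F → PrecedenceClosed I F
  precDense-closed F pd with PrecDense.candidate pd
  ... | inj₁ (a , eq) = subst (λ F → PrecedenceClosed I F) (sym eq)
    (listScheduling-closed (PrecDense.layer pd a) (PrecDense.layer-list pd a))
  ... | inj₂ (i , eq) = subst (λ F → PrecedenceClosed I F) (sym eq)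
    (listScheduling-closed (PrecDense.cone pd i) (PrecDense.cone-list pd i))

  -- The density bounds from layers and cones.

  module _ {F F* : Assignment I} (pd : PrecDense I F) (closed : PrecedenceClosed I F*) where
    open PrecDense pd

    private
      W = weight I (cov I F*)
      L = duration I F*
      P = weight I (cov I F)
      Q = duration I F

    -- Cross-multiplied form of `W/L ≤ (P/Q)(1 + k/(mL))`. Every set of `F*` has depth at most `L`
    -- and at most `maxDepth`, so it lies in the chosen layer.
    layer-bound : m ℕ.* (W ℕ.* Q) ℕ.≤ P ℕ.* (m ℕ.* L ℕ.+ k)
    layer-bound with a , a≤L , deepest ← layer-index (ℕ.≤-trans (depth-positive firstSet) (depth≤maxDepth firstSet))
                                           (ℕ.>-nonZero⁻¹ L {{duration-nonZero I F*}}) = begin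
      m ℕ.* (W ℕ.* Q)                                 ≤⟨ ℕ.*-monoʳ-≤ m (ℕ.*-monoˡ-≤ Q (weight-mono (cov-mono F* (layer a)
                                                           λ {i} s → proj₂ (layer-list a) i
                                                             (deepest (depth≤maxDepth i) (depth≤duration {F*} closed s))))) ⟩
      m ℕ.* (weight I (cov I (layer a)) ℕ.* Q)        ≤⟨ ℕ.*-monoʳ-≤ m (ratio-≤⁻ (density-ratio (layer a)) (density-ratio F) (layer-density a)) ⟩
      m ℕ.* (P ℕ.* duration I (layer a))              ≡⟨ swap m P _ ⟩
      P ℕ.* (m ℕ.* duration I (layer a))              ≤⟨ ℕ.*-monoʳ-≤ P (list-duration (layer a) (proj₁ (layer-list a)) (λ le → le) (λ {i} _ → ∈-allFin i)) ⟩
      P ℕ.* (m ℕ.* suc (toℕ a) ℕ.+ length (allFin k)) ≤⟨ ℕ.*-monoʳ-≤ P (ℕ.+-mono-≤ (ℕ.*-monoʳ-≤ m a≤L) (ℕ.≤-reflexive (length-allFin k))) ⟩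
      P ℕ.* (m ℕ.* L ℕ.+ k)                           ∎
      where
      open ℕ.≤-Reasoning
      swap : ∀ a b c → a ℕ.* (b ℕ.* c) ≡ b ℕ.* (a ℕ.* c)
      swap = solve-∀

    cone-scheduled : ∀ {i j} → Scheduled I (slots F*) i → 𝒫 I i j → Scheduled I (slots F*) j
    cone-scheduled s        (inj₁ refl) = s
    cone-scheduled (_ , eq) (inj₂ j≺i) with μ , t , eq′ , _ ← closed eq _ j≺i = (μ , t) , eq′

    -- The cone lies inside `F*`, so `F*` controls both terms of Graham's bound: depths are at most
    -- `L`, and the number of sets is at most `m * L`.
    cone-duration : ∀ {i} → Scheduled I (slots F*) i → duration I (cone i) ℕ.≤ 2 ℕ.* L
    cone-duration {i} s = ℕ.*-cancelˡ-≤ m {{ℕ.>-nonZero m≥1}} (begin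
      m ℕ.* duration I (cone i)              ≤⟨ list-duration (cone i) (proj₁ (cone-list i))
                                                  (depth≤duration {F*} closed ∘ cone-scheduled s)
                                                  (∈-scheduled⁺ F* ∘ cone-scheduled s) ⟩
      m ℕ.* L ℕ.+ length (scheduled F*)      ≤⟨ ℕ.+-monoʳ-≤ (m ℕ.* L) (scheduled≤m*duration F*) ⟩
      m ℕ.* L ℕ.+ m ℕ.* L                    ≡⟨ double m L ⟩
      m ℕ.* (2 ℕ.* L)                        ∎)
      where
      open ℕ.≤-Reasoning
      double : ∀ a b → a ℕ.* b ℕ.+ a ℕ.* b ≡ a ℕ.* (2 ℕ.* b)
      double = solve-∀

    -- Cross-multiplied form of `W/L ≤ 2T(P/Q)` with `T` sets in `F*`: each of them is covered by
    -- its own cone, which is no denser than `F`.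
    cone-bound : W ℕ.* Q ℕ.≤ length (scheduled F*) ℕ.* (P ℕ.* (2 ℕ.* L))
    cone-bound = weight-⋃ (scheduled F*) λ {i} i∈ → let s = ∈-scheduled⁻ F* i∈ in begin
      weight I (sets i) ℕ.* Q               ≤⟨ ℕ.*-monoˡ-≤ Q (weight-mono (sets⊆cov (cone i) (proj₂ (cone-list i) i (inj₁ refl)))) ⟩
      weight I (cov I (cone i)) ℕ.* Q       ≤⟨ ratio-≤⁻ (density-ratio (cone i)) (density-ratio F) (cone-density i) ⟩
      P ℕ.* duration I (cone i)             ≤⟨ ℕ.*-monoʳ-≤ P (cone-duration s) ⟩
      P ℕ.* (2 ℕ.* L)                       ∎
      where open ℕ.≤-Reasoning

    precDense-ratio : density I F* ³ ≤ (+ 2 / 1) ³ * ((+ k / 1) * (+ k / 1)) * density I F ³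
    -- The nesting of `ratio-*` mirrors the right-hand side; the denominators of `2` and `k` become
    -- the factors `1` in `cubic-bound`.
    precDense-ratio = ratio-≤⁺ (cube (density-ratio F*))
      (ratio-* (ratio-* (cube (whole 2)) (ratio-* (whole k) (whole k))) (cube (density-ratio F)))
      (cubic-bound {m} {k} {length (scheduled F*)} {W} {L} {P} {Q}
        (ℕ.*-mono-≤ m≥1 (ℕ.>-nonZero⁻¹ L {{duration-nonZero I F*}}))
        (scheduled≤k F*) (scheduled≤m*duration F*) layer-bound cone-bound)
      where
      cube : ∀ {p a b} → IsRatio p a b → IsRatio (p ³) (a ℕ.* a ℕ.* a) (b ℕ.* b ℕ.* b)
      cube r = ratio-* (ratio-* r r) r
      whole : ∀ a → IsRatio (+ a / 1) a 1
      whole a = _ , refl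

  -- Existence of an output of the algorithm.

  shallowest-depth : ∀ {i} → (∀ j → depth I i ℕ.≤ depth I j) → depth I i ℕ.≤ 1
  shallowest-depth {i} shallowest = source (proj₁ (proj₂ (depth-exists I i)))
    where
    source : ∀ {l} → PathTo I i l → l ℕ.≤ 1
    source (start _)         = ℕ.≤-refl
    -- An edge into a shallowest set would start at a still shallower one.
    source (_▻_ {j = j} _ e) = contradiction (shallowest j) (ℕ.<⇒≱ (depth-≺ [ e ]))

  -- Makes every layer nonempty, as an `Assignment` must schedule at least one set.
  shallowSet : ∃ λ i → depth I i ℕ.≤ 1
  shallowSet =
    let i , _ , shallowest = minimiser (λ _ → yes tt) (depth I) (firstSet , tt)
    in i , shallowest-depth (λ j → shallowest j tt)

  -- Ensures that the guarantee for all outputs is not vacuous.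
  precDense-exists : ∃ (PrecDense I)
  precDense-exists = best , record
    { layer         = layer
    ; layer-list    = λ a → proj₂ (layers a)
    ; cone          = cone
    ; cone-list     = λ i → proj₂ (cones i)
    ; candidate     = candidate (ℚ-Extrema.argmax-sel (density I) (cone firstSet) candidates)
    ; layer-density = λ a → dominates (∈-++⁺ˡ (∈-map⁺ layer (∈-allFin a)))
    ; cone-density  = λ i → dominates (∈-++⁺ʳ (map layer (allFin _)) (∈-map⁺ cone (∈-allFin i)))
    }
    where
    layers : ∀ (a : Fin (maxDepth I)) → ∃ (ListScheduling I (DepthAtMost I (suc (toℕ a))))
    layers a = listSchedule (λ i → depth I i ℕ.≤? suc (toℕ a)) (λ j≺i le → ℕ.≤-trans (ℕ.<⇒≤ (depth-≺ j≺i)) le)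
      (Product.map₂ (λ le → ℕ.≤-trans le (s≤s z≤n)) shallowSet)

    cones : ∀ i → ∃ (ListScheduling I (𝒫 I i))
    cones i = listSchedule (λ j → (j Fin.≟ i) ⊎-dec j ≺? i)
      (λ { j≺l (inj₁ refl) → inj₂ j≺l ; j≺l (inj₂ l≺i) → inj₂ (j≺l ++⁺ l≺i) }) (i , inj₁ refl)

    layer : Fin (maxDepth I) → Assignment I
    layer a = proj₁ (layers a)

    cone : Fin k → Assignment I
    cone i = proj₁ (cones i)

    candidates : List (Assignment I)
    candidates = map layer (allFin _) ++ map cone (allFin k)

    best : Assignment I
    -- The default value is itself a cone, so the maximiser is a legitimate candidate even when
    -- `argmax` returns the default.
    best = ℚ-Extrema.argmax (density I) (cone firstSet) candidates

    dominates : ∀ {F} → F ∈ₗ candidates → density I F ≤ density I best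
    dominates = All.lookup (ℚ-Extrema.f[xs]≤f[argmax] {f = density I} (cone firstSet) candidates)

    candidate : ∀ {F} → F ≡ cone firstSet ⊎ F ∈ₗ candidates → (∃ λ a → F ≡ layer a) ⊎ (∃ λ i → F ≡ cone i)
    candidate (inj₁ eq) = inj₂ (firstSet , eq)
    candidate (inj₂ F∈) = Sum.map (Product.map₂ proj₂ ∘ ∈-map⁻ layer) (Product.map₂ proj₂ ∘ ∈-map⁻ cone)
      (∈-++⁻ (map layer (allFin _)) F∈)

theorem5p1 : Σ ℚ λ A → 0ℚ < A ×
    ((I : Instance) →
    let k = + Instance.k I / 1 in
    ∃ (PrecDense I) ×
    (∀ F → PrecDense I F →
    PrecedenceClosed I F ×
    (∀ F* → Optimal I F* →
    density I F* ³ ≤ A ³ * (k * k) * density I F ³)))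
-- The cube of `2` is the product of the constants `4` and `2` in the quadratic and the linear
-- bound.
theorem5p1 = + 2 / 1 , ℚ.positive⁻¹ (+ 2 / 1) , λ I →
  precDense-exists I ,
  λ F pd → precDense-closed I F pd , λ F* (closed , _) → precDense-ratio I {F} {F*} pd closed
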